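{- Let $G$ be a connected graph with $\kappa(G)=1$ and let $B_1,\ldots,B_r$ be the blocks of $G$. Then $mvd(G)=\left(\sum_{i=1}^{r} mvd(B_i)\right)-r+1$.
   Context: All graphs are finite, simple, undirected and connected. A block of $G$ is a maximal connected subgraph of $G$ that has no cut-vertex. For a vertex-colored graph and two nonadjacent vertices $x,y$, an $x$-$y$ vertex cut is a set $S\subseteq V(G)\setminus\{x,y\}$ such that $x$ and $y$ lie in different components of $G-S$; it is monochromatic if all its vertices have the same color. A vertex-coloring is an MVD-coloring if every pair of nonadjacent vertices has a monochromatic vertex cut separating them. $mvd(G)$ is the maximum number of colors used by an MVD-coloring of $G$ (so $mvd(K_m)=m$). -}

module Defs where

open import Data.Nat using (ℕ; _+_; _∸_; _≤_)
open import Data.Fin using (Fin)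
open import Data.Bool using (Bool; true; false; _∧_; not)
open import Data.Product using (Σ; ∃; _×_)
open import Data.Sum using (_⊎_)
open import Data.List using (map; allFin)
open import Data.Nat.ListAction using (sum)
open import Data.Fin using (_≟_)
open import Relation.Nullary using (yes; no)
open import Relation.Nullary using (¬_)
open import Relation.Binary.PropositionalEquality using (_≡_; _≢_)

record Graph : Set where
  field
    n    : ℕ
    adj  : Fin n → Fin n → Bool
    sym  : ∀ u v → adj u v ≡ adj v u
    irr  : ∀ v → adj v v ≡ false
open Graph public

-- vertex subsets; a subset W stands for the induced subgraph G[W]
VSet : ℕ → Set
VSet n = Fin n → Bool

full : ∀ {n} → VSet n
full _ = true

_∖_ : ∀ {n} → VSet n → VSet n → VSet n
(W ∖ S) v = W v ∧ not (S v)

single : ∀ {n} → Fin n → VSet n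
single x v with x ≟ v
... | yes _ = true
... | no _ = false

_⊆_ : ∀ {n} → VSet n → VSet n → Set
W ⊆ W' = ∀ v → W v ≡ true → W' v ≡ true

data Walk (G : Graph) (W : VSet (n G)) : Fin (n G) → Fin (n G) → Set where
  here : ∀ {v} → W v ≡ true → Walk G W v v
  step : ∀ {u v w} → W u ≡ true → adj G u v ≡ true → Walk G W v w → Walk G W u w

Connected : (G : Graph) → VSet (n G) → Set
Connected G W = (∃ λ v → W v ≡ true)
              × (∀ u v → W u ≡ true → W v ≡ true → Walk G W u v)

CutVertex : (G : Graph) → VSet (n G) → Fin (n G) → Set
CutVertex G W v = W v ≡ true
  × ∃ λ x → ∃ λ y → (W ∖ single v) x ≡ true × (W ∖ single v) y ≡ true
      × ¬ Walk G (W ∖ single v) x y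

-- a block: maximal vertex set inducing a connected subgraph without cut-vertex
-- (maximal blocks are always induced subgraphs)
NoCutVertex : (G : Graph) → VSet (n G) → Set
NoCutVertex G W = ∀ v → ¬ CutVertex G W v

IsBlock : (G : Graph) → VSet (n G) → Set
IsBlock G B = Connected G B × NoCutVertex G B
  × (∀ B' → B ⊆ B' → Connected G B' → NoCutVertex G B' → B' ⊆ B)

-- κ(G) = 1 : G connected, nontrivial, and either G = K₂ (n = 2) or G has a cut-vertex
KappaOne : Graph → Set
KappaOne G = Connected G full × 2 ≤ n G
  × (n G ≡ 2 ⊎ ∃ λ v → CutVertex G full v)

MonoCut : (G : Graph) (W : VSet (n G)) {k : ℕ} → (Fin (n G) → Fin k)
        → Fin (n G) → Fin (n G) → Set
MonoCut G W c x y = Σ (VSet (n G)) λ S →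
    (∀ v → S v ≡ true → W v ≡ true × v ≢ x × v ≢ y)
  × (∀ u v → S u ≡ true → S v ≡ true → c u ≡ c v)
  × ¬ Walk G (W ∖ S) x y

IsMVDColoring : (G : Graph) (W : VSet (n G)) (k : ℕ) → (Fin (n G) → Fin k) → Set
IsMVDColoring G W k c =
    (∀ j → ∃ λ v → W v ≡ true × c v ≡ j)
  × (∀ x y → W x ≡ true → W y ≡ true → x ≢ y → adj G x y ≡ false → MonoCut G W c x y)

IsMvd : (G : Graph) → VSet (n G) → ℕ → Set
IsMvd G W m = (Σ (Fin (n G) → Fin m) λ c → IsMVDColoring G W m c)
  × (∀ k (c : Fin (n G) → Fin k) → IsMVDColoring G W k c → k ≤ m)

ΣFin : (r : ℕ) → (Fin r → ℕ) → ℕ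
ΣFin r f = sum (map f (allFin r))

{-# OPTIONS --safe #-}

-- If v is a cut vertex of a connected W, then W splits as W₁ ∪ W₂ with W₁ ∩ W₂ = {v} and no edge between
-- W₁ − v and W₂ − v, both parts being connected.  Here mvd W + 1 = mvd W₁ + mvd W₂: an MVD-coloring of W
-- restricts to both parts, whose color classes share at least the color of v; conversely, two colorings
-- agreeing exactly in the color of v glue, because a walk in W retracts onto W₁ (sending W₂ to v), and
-- {v} separates vertices lying in different parts.  Repeating this ends with sets without cut vertex.  A
-- connected set without cut vertex cannot straddle a split, so these final sets are exactly the blocks of G,
-- each occurring once.
module Submission where

open import Defs
open import Data.Nat using (ℕ; zero; suc; _+_; _∸_; _≤_; _<_; z≤n; s≤s)
open import Data.Nat.Properties using (≤-refl; ≤-trans; ≤-pred; suc-injective; +-mono-≤; +-mono-≤-<; +-comm; +-suc; m+n∸n≡m)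
open import Data.Nat.ListAction using (sum)
open import Data.Nat.ListAction.Properties using (sum-++; sum-↭)
open import Data.Nat.Solver using (module +-*-Solver)
open import Data.Fin using (Fin; zero; suc; punchIn; punchOut; splitAt; join; _↑ˡ_; _↑ʳ_; _≟_)
open import Data.Fin.Properties using (any?; all?; ¬∀⟶∃¬; injective⇒≤; punchIn-punchOut; punchInᵢ≢i; punchOut-punchIn; punchOut-cong; splitAt-join; join-splitAt)
open import Data.Bool using (Bool; true; false; if_then_else_)
open import Data.Bool.Properties using () renaming (_≟_ to _≟ᵇ_)
open import Data.Product using (Σ; ∃; _×_; _,_; proj₁; proj₂)
open import Data.Sum using (_⊎_; inj₁; inj₂; [_,_]′; swap)
open import Data.List using (List; []; _∷_; _++_; length; map; allFin)
open import Data.List.Properties using (length-++; length-tabulate; map-++)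
open import Data.List.Membership.Propositional using (_∈_)
open import Data.List.Membership.Propositional.Properties using (∈-++⁺ˡ; ∈-++⁺ʳ; ∈-++⁻; ∈-allFin)
open import Data.List.Membership.Propositional.Properties.WithK using (unique∧set⇒bag)
open import Data.List.Relation.Binary.BagAndSetEquality using (∼bag⇒↭)
open import Data.List.Relation.Binary.Permutation.Propositional using (_↭_)
open import Data.List.Relation.Binary.Permutation.Propositional.Properties using (map⁺; ↭-length)
open import Data.List.Relation.Unary.All using ([])
open import Data.List.Relation.Unary.AllPairs using ([]; _∷_)
open import Data.List.Relation.Unary.Any using (here)
open import Data.List.Relation.Unary.Unique.Propositional using (Unique)
open import Data.List.Relation.Unary.Unique.Propositional.Properties using (++⁺; allFin⁺)
open import Function using (_∘_; id; mk⇔)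
open import Relation.Nullary using (¬_; Dec; yes; no; does; contradiction)
open import Relation.Nullary.Decidable using (_×-dec_; _⊎-dec_; ¬?; map′; dec-true; dec-false)
open import Relation.Binary.PropositionalEquality using (_≡_; _≢_; refl; trans; cong; cong₂; subst; module ≡-Reasoning) renaming (sym to ≡-sym)

-- Vertex sets

module _ {k : ℕ} where

  ∈-or-∉ : ∀ (W : VSet k) v → W v ≡ true ⊎ W v ≡ false
  ∈-or-∉ W v with W v
  ... | true  = inj₁ refl
  ... | false = inj₂ refl

  ∈∉⇒⊥ : ∀ (W : VSet k) {v} {A : Set} → W v ≡ true → W v ≡ false → A
  ∈∉⇒⊥ W p q with () ← trans (≡-sym p) q

  ∖⁺ : ∀ (W S : VSet k) {v} → W v ≡ true → S v ≡ false → (W ∖ S) v ≡ true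
  ∖⁺ W S p q rewrite p | q = refl

  ∖⁻ : ∀ (W S : VSet k) {v} → (W ∖ S) v ≡ true → W v ≡ true × S v ≡ false
  ∖⁻ W S {v} p with W v | S v
  ... | true | false = refl , refl

  ∖-∈⇒∉ : ∀ (W S : VSet k) {v} → S v ≡ true → (W ∖ S) v ≡ false
  ∖-∈⇒∉ W S {v} p rewrite p with W v
  ... | true  = refl
  ... | false = refl

  single-refl : ∀ v → single {k} v v ≡ true
  single-refl v with v ≟ v
  ... | yes _  = refl
  ... | no v≢v = contradiction refl v≢v

  single-≡ : ∀ {x y} → single {k} x y ≡ true → x ≡ y
  single-≡ {x} {y} p with x ≟ y
  ... | yes x≡y = x≡y

  single-≢ : ∀ {x y} → x ≢ y → single {k} x y ≡ false
  single-≢ {x} {y} x≢y with x ≟ y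
  ... | yes x≡y = contradiction x≡y x≢y
  ... | no _    = refl

  single-≢⁻ : ∀ {x y} → single {k} x y ≡ false → x ≢ y
  single-≢⁻ {x} p refl = ∈∉⇒⊥ (single x) (single-refl x) p

  ∖single⁺ : ∀ (W : VSet k) {x v} → W v ≡ true → x ≢ v → (W ∖ single x) v ≡ true
  ∖single⁺ W p x≢v = ∖⁺ W (single _) p (single-≢ x≢v)

  ⊆-antisym : ∀ {W W' : VSet k} → W ⊆ W' → W' ⊆ W → ∀ v → W v ≡ W' v
  ⊆-antisym {W} {W'} p q v with ∈-or-∉ W v | ∈-or-∉ W' v
  ... | inj₁ a | _      = trans a (≡-sym (p v a))
  ... | inj₂ a | inj₁ b = ∈∉⇒⊥ W (q v b) a
  ... | inj₂ a | inj₂ b = trans a (≡-sym b)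

  ≗⇒⊆ : ∀ {W W' : VSet k} → (∀ v → W v ≡ W' v) → W ⊆ W'
  ≗⇒⊆ eq v p = trans (≡-sym (eq v)) p

  -- Written with _∖_ so that ∖⁺ and ∖⁻ apply to it.
  _∩_ : VSet k → VSet k → VSet k
  W ∩ W' = W ∖ (full ∖ W')

-- Sizes of vertex sets and counts of colors

indicator : Bool → ℕ
indicator b = if b then 1 else 0

size : ∀ {k} → VSet k → ℕ
size {zero}  W = 0
size {suc k} W = indicator (W zero) + size (W ∘ suc)

indicator-mono : ∀ {b b'} → (b ≡ true → b' ≡ true) → indicator b ≤ indicator b'
indicator-mono {true}  f rewrite f refl = ≤-refl
indicator-mono {false} f = z≤n

size-mono : ∀ {k} {W W' : VSet k} → W ⊆ W' → size W ≤ size W'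
size-mono {zero}  p = z≤n
size-mono {suc k} p = +-mono-≤ (indicator-mono (p zero)) (size-mono (p ∘ suc))

size-mono-< : ∀ {k} {W W' : VSet k} → W ⊆ W' → ∀ v → W v ≡ false → W' v ≡ true → size W < size W'
size-mono-< p zero a b rewrite a | b = s≤s (size-mono (p ∘ suc))
size-mono-< p (suc v) a b = +-mono-≤-< (indicator-mono (p zero)) (size-mono-< (p ∘ suc) v a b)

surjective⇒≤ : ∀ {k l} (s : Fin l → Fin k) → (∀ j → ∃ λ i → s i ≡ j) → k ≤ l
surjective⇒≤ s sur = injective⇒≤ {f = λ j → proj₁ (sur j)}
  (λ {i} {j} eq → trans (≡-sym (proj₂ (sur i))) (trans (cong s eq) (proj₂ (sur j))))

compress : ∀ {n k} (W : VSet n) v → W v ≡ true → (c : Fin n → Fin k)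
  → Σ ℕ λ l → Σ (Fin k → Fin l) λ d → Σ (Fin l → Fin k) λ e
    → (∀ u → W u ≡ true → e (d (c u)) ≡ c u)
    × (∀ j → ∃ λ u → W u ≡ true × d (c u) ≡ j)
compress {k = zero} W v v∈W c with () ← c v
compress {k = suc k} W v v∈W c
  with all? (λ j → any? λ u → (W u ≟ᵇ true) ×-dec (c u ≟ j))
... | yes sur = suc k , id , id , (λ _ _ → refl) , sur
... | no ¬sur
  with j , unused ← ¬∀⟶∃¬ _ _ (λ j → any? λ u → (W u ≟ᵇ true) ×-dec (c u ≟ j)) ¬sur =
  let l , d , e , ed , sur = compress W v v∈W (d₀ ∘ c)
  in l , d ∘ d₀ , punchIn j ∘ e
     , (λ u u∈W → trans (cong (punchIn j) (ed u u∈W)) (punchIn-d₀ (used u u∈W))) , sur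
  where
  used : ∀ u → W u ≡ true → j ≢ c u
  used u u∈W eq = unused (u , u∈W , ≡-sym eq)
  d₀ : Fin (suc k) → Fin k
  d₀ i with j ≟ i
  -- The deleted color `j` needs some image for `d₀` to be total. The image of the color of `v`
  -- serves as a default; no vertex of `W` has color `j`.
  ... | yes _  = punchOut (used v v∈W)
  ... | no j≢i = punchOut j≢i
  punchIn-d₀ : ∀ {i} → j ≢ i → punchIn j (d₀ i) ≡ i
  punchIn-d₀ {i} j≢i with j ≟ i
  ... | yes j≡i = contradiction j≡i j≢i
  ... | no j≢i' = punchIn-punchOut j≢i'

module _ (G : Graph) where

  private
    V = Fin (n G)

  -- Walks

  walk-start : ∀ {W u v} → Walk G W u v → W u ≡ true
  walk-start (here p)     = p
  walk-start (step p _ _) = p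

  walk-end : ∀ {W u v} → Walk G W u v → W v ≡ true
  walk-end (here p)     = p
  walk-end (step _ _ w) = walk-end w

  walk-mono : ∀ {W W' u v} → W ⊆ W' → Walk G W u v → Walk G W' u v
  walk-mono p (here q)     = here (p _ q)
  walk-mono p (step q e w) = step (p _ q) e (walk-mono p w)

  walk-snoc : ∀ {W u v w} → Walk G W u v → adj G v w ≡ true → W w ≡ true → Walk G W u w
  walk-snoc (here p)     e q = step p e (here q)
  walk-snoc (step p a w) e q = step p a (walk-snoc w e q)

  Departs : VSet (n G) → V → V → Set
  Departs W x y = x ≡ y ⊎ ∃ λ u → adj G x u ≡ true × Walk G (W ∖ single x) u y

  -- Cut the walk at its last visit to x.
  last-visit : ∀ {W z y} x → Walk G W z y → Walk G (W ∖ single x) z y ⊎ Departs W x y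
  last-visit {W} {z} x (here p) with x ≟ z
  ... | yes x≡z = inj₂ (inj₁ x≡z)
  ... | no x≢z  = inj₁ (here (∖single⁺ W p x≢z))
  last-visit {W} {z} x (step p e w) with last-visit x w
  ... | inj₂ d = inj₂ d
  ... | inj₁ w' with x ≟ z
  ... | yes refl = inj₂ (inj₂ (_ , e , w'))
  ... | no x≢z   = inj₁ (step (∖single⁺ W p x≢z) e w')

  -- After its last visit to `x` a walk stays in `W` without `x`, a smaller set, so recursion on a
  -- bound for the size decides reachability.
  walk?-bounded : ∀ k W → size W ≤ k → ∀ x y → Dec (Walk G W x y)
  walk?-bounded k W b x y with ∈-or-∉ W x
  ... | inj₂ x∉W = no λ w → ∈∉⇒⊥ W (walk-start w) x∉W
  walk?-bounded zero W b x y | inj₁ x∈W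
    with () ← ≤-trans (size-mono-< {W = λ _ → false} {W} (λ _ ()) x refl x∈W) b
  walk?-bounded (suc k) W b x y | inj₁ x∈W =
    map′ arrive depart ((x ≟ y) ⊎-dec any? λ u → (adj G x u ≟ᵇ true) ×-dec walk?-bounded k (W ∖ single x) b' u y)
    where
    shrinks : size (W ∖ single x) < size W
    shrinks = size-mono-< (λ v → proj₁ ∘ ∖⁻ W (single x)) x (∖-∈⇒∉ W (single x) (single-refl x)) x∈W
    b' : size (W ∖ single x) ≤ k
    b' = ≤-pred (≤-trans shrinks b)
    arrive : Departs W x y → Walk G W x y
    arrive (inj₁ refl)        = here x∈W
    arrive (inj₂ (u , e , w)) = step x∈W e (walk-mono (λ v → proj₁ ∘ ∖⁻ W (single x)) w)
    depart : Walk G W x y → Departs W x y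
    depart w with last-visit x w
    ... | inj₂ d  = d
    ... | inj₁ w' = ∈∉⇒⊥ (W ∖ single x) (walk-start w') (∖-∈⇒∉ W (single x) (single-refl x))

  walk? : ∀ W x y → Dec (Walk G W x y)
  walk? W = walk?-bounded (size W) W ≤-refl

  cutVertex? : ∀ W → Dec (∃ λ v → CutVertex G W v)
  cutVertex? W = any? λ v → (W v ≟ᵇ true) ×-dec any? λ x → any? λ y →
    ((W ∖ single v) x ≟ᵇ true) ×-dec ((W ∖ single v) y ≟ᵇ true) ×-dec ¬? (walk? (W ∖ single v) x y)

  -- Splitting at a cut vertex

  -- A separation of order one. Connectedness and strict smallness of the sides are established
  -- apart from it.
  record Split (W W₁ W₂ : VSet (n G)) (v : V) : Set where
    field
      sub₁    : W₁ ⊆ W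
      sub₂    : W₂ ⊆ W
      cover   : ∀ u → W u ≡ true → W₁ u ≡ true ⊎ W₂ u ≡ true
      v∈₁     : W₁ v ≡ true
      v∈₂     : W₂ v ≡ true
      meet    : ∀ {u} → W₁ u ≡ true → W₂ u ≡ true → u ≡ v
      no-edge : ∀ {u w} → W₁ u ≡ true → W₂ w ≡ true → adj G u w ≡ true → u ≡ v ⊎ w ≡ v

  split-swap : ∀ {W W₁ W₂ v} → Split W W₁ W₂ v → Split W W₂ W₁ v
  split-swap s = record
    { sub₁ = sub₂ ; sub₂ = sub₁ ; cover = λ u → swap ∘ cover u ; v∈₁ = v∈₂ ; v∈₂ = v∈₁
    ; meet = λ p q → meet q p
    ; no-edge = λ {u} {w} p q e → swap (no-edge q p (trans (sym G w u) e)) }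
    where open Split s

  module _ {W W₁ W₂ : VSet (n G)} {v : V} (s : Split W W₁ W₂ v) where
    open Split s

    ∉₂⇒∈₁ : ∀ {u} → W u ≡ true → W₂ u ≡ false → W₁ u ≡ true
    ∉₂⇒∈₁ {u} p q with cover u p
    ... | inj₁ r = r
    ... | inj₂ r = ∈∉⇒⊥ W₂ r q

    -- Collapsing W₂ to v maps walks in X ⊆ W ending in W₁ to walks in X ∩ W₁ ⊆ Y.
    retract : ∀ {X Y u y} → X ⊆ W → (∀ z → X z ≡ true → W₁ z ≡ true → Y z ≡ true)
      → W₁ y ≡ true → Walk G X u y
      → (W₁ u ≡ true → Walk G Y u y) × (W₂ u ≡ true → Walk G Y v y)
    retract X⊆W into y∈ (here p) =
      (λ _ → here (into _ p y∈)) , λ y∈₂ → subst (λ z → Walk G _ z _) (meet y∈ y∈₂) (here (into _ p y∈))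
    retract {X} {Y} {u} {y} X⊆W into y∈ (step {v = u'} p e w) = from₁ , from₂
      where
      rec = retract X⊆W into y∈ w
      at-v : ∀ {z} → z ≡ v → W₁ z ≡ true
      at-v refl = v∈₁
      from₁ : W₁ u ≡ true → Walk G Y u y
      from₁ u∈ with cover u' (X⊆W u' (walk-start w))
      ... | inj₁ u'∈₁ = step (into u p u∈) e (proj₁ rec u'∈₁)
      -- The edge leaves `W₁`, so one of its ends is `v`: it either collapses to a standstill at `v`
      -- or is itself the arrival at `v`.
      ... | inj₂ u'∈₂ with no-edge u∈ u'∈₂ e
      ... | inj₁ refl = proj₂ rec u'∈₂
      ... | inj₂ u'≡v = step (into u p u∈) e (proj₁ rec (at-v u'≡v))
      from₂ : W₂ u ≡ true → Walk G Y v y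
      from₂ u∈ with cover u' (X⊆W u' (walk-start w))
      ... | inj₂ u'∈₂ = proj₂ rec u'∈₂
      ... | inj₁ u'∈₁ with no-edge u'∈₁ u∈ (trans (sym G u' u) e)
      ... | inj₁ refl = proj₁ rec u'∈₁
      ... | inj₂ refl = from₁ v∈₁

    -- The only passage from `W₁` to the rest of `W` is `v`, which `X` lacks.
    stays-in₁ : ∀ {X x y} → X ⊆ W → X v ≡ false → W₁ x ≡ true → Walk G X x y → W₁ y ≡ true
    stays-in₁ X⊆W v∉X x∈ (here p) = x∈
    stays-in₁ {X} X⊆W v∉X x∈ (step {v = u} p e w) with cover u (X⊆W u (walk-start w))
    ... | inj₁ u∈₁ = stays-in₁ X⊆W v∉X u∈₁ w
    ... | inj₂ u∈₂ with no-edge x∈ u∈₂ e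
    ... | inj₁ refl = ∈∉⇒⊥ X p v∉X
    ... | inj₂ refl = ∈∉⇒⊥ X (walk-start w) v∉X

    separated : ∀ {X x y} → X ⊆ W → W₁ x ≡ true → W₁ y ≡ false → ¬ Walk G (X ∖ single v) x y
    separated {X} X⊆W x∈ y∉ w = ∈∉⇒⊥ W₁
      (stays-in₁ (λ u → X⊆W u ∘ proj₁ ∘ ∖⁻ X (single v)) (∖-∈⇒∉ X (single v) (single-refl v)) x∈ w) y∉

    connected₁ : Connected G W → Connected G W₁
    connected₁ (_ , conn) = (v , v∈₁) , λ x y x∈ y∈ →
      proj₁ (retract (λ _ → id) (λ _ _ → id) y∈ (conn x y (sub₁ x x∈) (sub₁ y y∈))) x∈

    -- Let `x` in `C` lie outside `W₂`, and suppose `y` in `C` lies outside `W₁`. If `v` is not in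
    -- `C`, a walk in `C` from `x` never leaves `W₁`; if `v` is in `C`, it separates `x` from `y`
    -- there and is a cut vertex of `C`.
    no-straddle : ∀ {C} → Connected G C → NoCutVertex G C → C ⊆ W
      → ∀ {x y} → C x ≡ true → W₂ x ≡ false → C y ≡ true → W₁ y ≡ true
    no-straddle {C} (_ , conn) ncv C⊆W {x} {y} x∈ x∉₂ y∈ with ∈-or-∉ W₁ y
    ... | inj₁ y∈₁ = y∈₁
    ... | inj₂ y∉₁ with ∈-or-∉ C v
    ... | inj₂ v∉C = stays-in₁ C⊆W v∉C (∉₂⇒∈₁ (C⊆W x x∈) x∉₂) (conn x y x∈ y∈)
    ... | inj₁ v∈C = contradiction
      (v∈C , x , y , ∖single⁺ C x∈ (λ { refl → ∈∉⇒⊥ W₂ v∈₂ x∉₂ }) , ∖single⁺ C y∈ (λ { refl → ∈∉⇒⊥ W₁ v∈₁ y∉₁ })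
        , separated C⊆W (∉₂⇒∈₁ (C⊆W x x∈) x∉₂) y∉₁) (ncv v)

    one-side : ∀ {C} → Connected G C → NoCutVertex G C → C ⊆ W → C ⊆ W₁ ⊎ C ⊆ W₂
    one-side {C} conn ncv C⊆W with any? (λ x → (C x ≟ᵇ true) ×-dec (W₂ x ≟ᵇ false))
    ... | yes (x , x∈ , x∉₂) = inj₁ λ y → no-straddle conn ncv C⊆W x∈ x∉₂
    ... | no ¬x = inj₂ λ y y∈ → [ id , (λ y∉ → contradiction (y , y∈ , y∉) ¬x) ]′ (∈-or-∉ W₂ y)

    -- Colorings

    -- The same set `S` works: a walk in `W` avoiding `S` would retract to a walk in `W₁` avoiding
    -- `S`. Since `c` factors through `c₁` on `W₁`, the set stays monochromatic.
    cut-extend : ∀ {k l} {c₁ : V → Fin k} {c : V → Fin l} (f : Fin k → Fin l)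
      → (∀ u → W₁ u ≡ true → c u ≡ f (c₁ u))
      → ∀ {x y} → W₁ x ≡ true → W₁ y ≡ true → MonoCut G W₁ c₁ x y → MonoCut G W c x y
    cut-extend f c≡ x∈ y∈ (S , S-in , mono , cut) =
      S , (λ u u∈S → let u∈ , ≢x , ≢y = S-in u u∈S in sub₁ u u∈ , ≢x , ≢y)
      , (λ u w u∈S w∈S → trans (c≡ u (proj₁ (S-in u u∈S)))
          (trans (cong f (mono u w u∈S w∈S)) (≡-sym (c≡ w (proj₁ (S-in w w∈S))))))
      , λ walk → cut (proj₁ (retract (λ u → proj₁ ∘ ∖⁻ W S)
          (λ u u∈ u∈₁ → ∖⁺ W₁ S u∈₁ (proj₂ (∖⁻ W S u∈))) y∈ walk) x∈)

    cut-vertex-cut : ∀ {k} {c : V → Fin k} {x y} → W₁ x ≡ true → x ≢ v → W₁ y ≡ false → MonoCut G W c x y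
    cut-vertex-cut {c = c} {x} {y} x∈ x≢v y∉ =
      single v
      , (λ u u∈ → subst (λ z → W z ≡ true × z ≢ x × z ≢ y) (single-≡ u∈)
          (sub₁ v v∈₁ , (λ v≡x → x≢v (≡-sym v≡x)) , λ { refl → ∈∉⇒⊥ W₁ v∈₁ y∉ }))
      , (λ u w u∈ w∈ → cong c (trans (≡-sym (single-≡ u∈)) (single-≡ w∈)))
      , separated (λ _ → id) x∈ y∉

  -- A walk in `W'` that avoids the trace of `S` on `W'` is a walk in `W` that avoids `S`.
  cut-restrict : ∀ {W W' k l} {c : V → Fin k} (d : Fin k → Fin l) → W' ⊆ W
    → ∀ {x y} → MonoCut G W c x y → MonoCut G W' (d ∘ c) x y
  cut-restrict {W} {W'} d W'⊆W (S , S-in , mono , cut) =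
    S ∩ W'
    , (λ u u∈ → inside u u∈ , proj₂ (S-in u (proj₁ (∖⁻ S (full ∖ W') u∈))))
    , (λ u w u∈ w∈ → cong d (mono u w (proj₁ (∖⁻ S (full ∖ W') u∈)) (proj₁ (∖⁻ S (full ∖ W') w∈))))
    , cut ∘ walk-mono avoid
    where
    inside : (S ∩ W') ⊆ W'
    inside u u∈ with ∈-or-∉ W' u
    ... | inj₁ p = p
    ... | inj₂ p = ∈∉⇒⊥ (full ∖ W') (∖⁺ full W' refl p) (proj₂ (∖⁻ S (full ∖ W') u∈))
    avoid : (W' ∖ (S ∩ W')) ⊆ (W ∖ S)
    avoid u u∈ with ∖⁻ W' (S ∩ W') u∈
    ... | u∈W' , u∉ = ∖⁺ W S (W'⊆W u u∈W') ([ (λ u∈S → ∈∉⇒⊥ (S ∩ W')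
            (∖⁺ S (full ∖ W') u∈S (∖-∈⇒∉ full W' u∈W')) u∉) , id ]′ (∈-or-∉ S u))

  -- Vertex sets are Boolean functions compared pointwise, so invariance has to be proved; each cut
  -- is carried over by restriction to the equal set.
  mvd-cong : ∀ {W W' m} → (∀ u → W u ≡ W' u) → IsMvd G W m → IsMvd G W' m
  mvd-cong eq ((c , good) , max) = (c , transport eq good) , λ k c' good' → max k c' (transport (≡-sym ∘ eq) good')
    where
    transport : ∀ {W W' k} {c : V → Fin k} → (∀ u → W u ≡ W' u) → IsMVDColoring G W k c → IsMVDColoring G W' k c
    transport eq (sur , cuts) =
      (λ j → let u , u∈ , cu≡ = sur j in u , ≗⇒⊆ eq u u∈ , cu≡)
      , λ x y x∈ y∈ x≢y na → cut-restrict id (≗⇒⊆ (≡-sym ∘ eq)) (cuts x y (≗⇒⊆ (≡-sym ∘ eq) x x∈) (≗⇒⊆ (≡-sym ∘ eq) y y∈) x≢y na)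

  restrict-coloring : ∀ {W W' k l} {c : V → Fin k} (d : Fin k → Fin l) → W' ⊆ W
    → (∀ j → ∃ λ u → W' u ≡ true × d (c u) ≡ j)
    → IsMVDColoring G W k c → IsMVDColoring G W' l (d ∘ c)
  restrict-coloring d W'⊆W sur (_ , cuts) = sur , λ x y x∈ y∈ x≢y na →
    cut-restrict d W'⊆W (cuts x y (W'⊆W x x∈) (W'⊆W y y∈) x≢y na)

  module _ {W W₁ W₂ : VSet (n G)} {v : V} (s : Split W W₁ W₂ v) where
    open Split s

    -- Two vertices on a common side inherit the cut of that side; otherwise `v` alone separates
    -- them. The remaining cases contradict `cover`.
    split-cuts : ∀ {k a b} {c : V → Fin k} {c₁ : V → Fin a} {c₂ : V → Fin b} (f : Fin a → Fin k) (g : Fin b → Fin k)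
      → (∀ u → W₁ u ≡ true → c u ≡ f (c₁ u)) → (∀ u → W₂ u ≡ true → c u ≡ g (c₂ u))
      → IsMVDColoring G W₁ a c₁ → IsMVDColoring G W₂ b c₂
      → ∀ x y → W x ≡ true → W y ≡ true → x ≢ y → adj G x y ≡ false → MonoCut G W c x y
    split-cuts f g c≡f c≡g (_ , cuts₁) (_ , cuts₂) x y x∈ y∈ x≢y na
      with ∈-or-∉ W₁ x | ∈-or-∉ W₁ y | ∈-or-∉ W₂ x | ∈-or-∉ W₂ y
    ... | inj₁ p | inj₁ q | _ | _ = cut-extend s f c≡f p q (cuts₁ x y p q x≢y na)
    ... | _ | _ | inj₁ p | inj₁ q = cut-extend (split-swap s) g c≡g p q (cuts₂ x y p q x≢y na)
    ... | inj₁ p | inj₂ q | inj₂ r | _ = cut-vertex-cut s p (λ { refl → ∈∉⇒⊥ W₂ v∈₂ r }) q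
    ... | inj₁ p | inj₂ q | inj₁ r | inj₂ t = ∈∉⇒⊥ W₂ (∉₂⇒∈₁ (split-swap s) y∈ q) t
    ... | inj₂ p | _ | inj₂ r | _ = ∈∉⇒⊥ W₂ (∉₂⇒∈₁ (split-swap s) x∈ p) r
    ... | inj₂ p | _ | inj₁ r | inj₂ t = cut-vertex-cut (split-swap s) r (λ { refl → ∈∉⇒⊥ W₁ v∈₁ p }) t

    -- The palette is that of `c₁` followed by `b` fresh colors. The map `g` identifies `c₂ v` with
    -- `c₁ v` and sends the other `b` colors of `c₂` to the fresh ones.
    glue : ∀ {a b} → (c₁ : V → Fin a) → IsMVDColoring G W₁ a c₁ → (c₂ : V → Fin (suc b)) → IsMVDColoring G W₂ (suc b) c₂
      → Σ (V → Fin (a + b)) (IsMVDColoring G W (a + b))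
    glue {a} {b} c₁ good₁ c₂ good₂ = c , surjective , split-cuts (_↑ˡ b) g c≡f c≡g good₁ good₂
      where
      g : Fin (suc b) → Fin (a + b)
      g j with c₂ v ≟ j
      ... | yes _ = c₁ v ↑ˡ b
      ... | no ≢j = a ↑ʳ punchOut ≢j
      g-v : g (c₂ v) ≡ c₁ v ↑ˡ b
      g-v with c₂ v ≟ c₂ v
      ... | yes _ = refl
      ... | no ≢  = contradiction refl ≢
      g-punchIn : ∀ i → g (punchIn (c₂ v) i) ≡ a ↑ʳ i
      g-punchIn i with c₂ v ≟ punchIn (c₂ v) i
      ... | yes eq = contradiction (≡-sym eq) (punchInᵢ≢i (c₂ v) i)
      ... | no _   = cong (a ↑ʳ_) (trans (punchOut-cong (c₂ v) refl) (punchOut-punchIn (c₂ v)))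
      c : V → Fin (a + b)
      c u = if W₁ u then c₁ u ↑ˡ b else g (c₂ u)
      c≡f : ∀ u → W₁ u ≡ true → c u ≡ c₁ u ↑ˡ b
      c≡f u p rewrite p = refl
      c≡g : ∀ u → W₂ u ≡ true → c u ≡ g (c₂ u)
      c≡g u p with ∈-or-∉ W₁ u
      ... | inj₂ q rewrite q = refl
      -- The sides share only `v`, where both definitions give the color `c₁ v`.
      ... | inj₁ q with refl ← meet q p = trans (c≡f u q) (≡-sym g-v)
      surjective : ∀ j → ∃ λ u → W u ≡ true × c u ≡ j
      surjective j with splitAt a j | join-splitAt a b j
      ... | inj₁ i | refl = let u , u∈ , eq = proj₁ good₁ i in
        u , sub₁ u u∈ , trans (c≡f u u∈) (cong (_↑ˡ b) eq)
      ... | inj₂ i | refl = let u , u∈ , eq = proj₁ good₂ (punchIn (c₂ v) i) in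
        u , sub₂ u u∈ , trans (c≡g u u∈) (trans (cong g eq) (g-punchIn i))

    -- The color of v is counted in both parts, so the second part contributes all its colors but one.
    colors-bound : ∀ {a b k} → IsMvd G W₁ a → IsMvd G W₂ (suc b) → (c : V → Fin k) → IsMVDColoring G W k c → k ≤ a + b
    colors-bound {a} {b} {k} (_ , max₁) (_ , max₂) c good
      with compress W₁ v v∈₁ c | compress W₂ v v∈₂ c
    ... | _ , _ , _ , _ , _ | zero , d₂ , _ with () ← d₂ (c v)
    colors-bound {a} {b} {k} (_ , max₁) (_ , max₂) c good
      | l₁ , d₁ , e₁ , ed₁ , sur₁ | suc l₂ , d₂ , e₂ , ed₂ , sur₂ =
      ≤-trans (surjective⇒≤ paint painted)
        (+-mono-≤ (max₁ l₁ (d₁ ∘ c) (restrict-coloring d₁ sub₁ sur₁ good))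
                  (≤-pred (max₂ (suc l₂) (d₂ ∘ c) (restrict-coloring d₂ sub₂ sur₂ good))))
      where
      -- The second summand enumerates the colors of `W₂` with the color of `v` left out.
      pick : Fin l₁ ⊎ Fin l₂ → Fin k
      pick = [ e₁ , e₂ ∘ punchIn (d₂ (c v)) ]′
      paint : Fin (l₁ + l₂) → Fin k
      paint = pick ∘ splitAt l₁
      by-join : ∀ i {j} → pick i ≡ j → ∃ λ i' → paint i' ≡ j
      by-join i eq = join l₁ l₂ i , trans (cong pick (splitAt-join l₁ l₂ i)) eq
      painted : ∀ j → ∃ λ i → paint i ≡ j
      painted j with proj₁ good j
      ... | u , u∈ , refl with cover u u∈
      ... | inj₁ u∈₁ = by-join (inj₁ (d₁ (c u))) (ed₁ u u∈₁)
      ... | inj₂ u∈₂ with d₂ (c v) ≟ d₂ (c u)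
      ... | no ≢   = by-join (inj₂ (punchOut ≢)) (trans (cong e₂ (punchIn-punchOut ≢)) (ed₂ u u∈₂))
      -- The omitted color is that of `v`, which the first summand supplies.
      ... | yes eq = by-join (inj₁ (d₁ (c v)))
        (trans (ed₁ v v∈₁) (trans (≡-sym (ed₂ v v∈₂)) (trans (cong e₂ eq) (ed₂ u u∈₂))))

    mvd-split : ∀ {a b} → IsMvd G W₁ a → IsMvd G W₂ b → ∃ λ M → IsMvd G W M × suc M ≡ a + b
    -- The vertex `v` has a color, so `b` is positive and the shared color can be taken off.
    mvd-split {b = zero} mvd₁ ((c₂ , _) , _) with () ← c₂ v
    mvd-split {a} {suc b} mvd₁@((c₁ , good₁) , _) mvd₂@((c₂ , good₂) , _) =
      a + b , (glue c₁ good₁ c₂ good₂ , λ k → colors-bound mvd₁ mvd₂) , ≡-sym (+-suc a b)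

  -- Existence of splits and recognition of blocks

  Nontrivial : VSet (n G) → Set
  Nontrivial W = ∃ λ x → ∃ λ y → W x ≡ true × W y ≡ true × x ≢ y

  -- The side of x in W − v, and the union of the other components, each together with v.
  cut-split : ∀ {W} → ((v , _) : ∃ (CutVertex G W)) → ∃ λ W₁ → ∃ λ W₂ → Split W W₁ W₂ v
    × Nontrivial W₁ × Nontrivial W₂ × size W₁ < size W × size W₂ < size W
  cut-split {W} (v , v∈ , x , y , x∈ , y∈ , no-walk) =
    W₁ , W₂
    , record { sub₁ = sub₁ ; sub₂ = sub₂ ; cover = cover ; v∈₁ = v∈₁ ; v∈₂ = v∈₂ ; meet = meet ; no-edge = no-edge }
    , (v , x , v∈₁ , x∈₁ , v≢x) , (v , y , v∈₂ , y∈₂ , v≢y)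
    , size-mono-< sub₁ y y∉₁ (proj₁ (∖⁻ W (single v) y∈))
    , size-mono-< sub₂ x x∉₂ (proj₁ (∖⁻ W (single v) x∈))
    where
    R : V → Set
    R u = Walk G (W ∖ single v) x u
    R? : ∀ u → Dec (R u)
    R? = walk? (W ∖ single v) x
    W₁? : ∀ u → Dec (v ≡ u ⊎ R u)
    W₁? u = (v ≟ u) ⊎-dec R? u
    W₂? : ∀ u → Dec (v ≡ u ⊎ (W u ≡ true × ¬ R u))
    W₂? u = (v ≟ u) ⊎-dec ((W u ≟ᵇ true) ×-dec ¬? (R? u))
    W₁ W₂ : VSet (n G)
    W₁ u = does (W₁? u)
    W₂ u = does (W₂? u)
    true⇒ : ∀ {A : Set} (A? : Dec A) → does A? ≡ true → A
    true⇒ (yes a) _ = a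
    v≢x : v ≢ x
    v≢x = single-≢⁻ (proj₂ (∖⁻ W (single v) x∈))
    v≢y : v ≢ y
    v≢y = single-≢⁻ (proj₂ (∖⁻ W (single v) y∈))
    v∈₁ = dec-true (W₁? v) (inj₁ refl)
    v∈₂ = dec-true (W₂? v) (inj₁ refl)
    x∈₁ = dec-true (W₁? x) (inj₂ (here x∈))
    y∈₂ = dec-true (W₂? y) (inj₂ (proj₁ (∖⁻ W (single v) y∈) , no-walk))
    y∉₁ = dec-false (W₁? y) [ v≢y , no-walk ]′
    x∉₂ = dec-false (W₂? x) [ v≢x , (λ (_ , ¬Rx) → ¬Rx (here x∈)) ]′
    sub₁ : W₁ ⊆ W
    sub₁ u p with true⇒ (W₁? u) p
    ... | inj₁ refl = v∈
    ... | inj₂ w    = proj₁ (∖⁻ W (single v) (walk-end w))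
    sub₂ : W₂ ⊆ W
    sub₂ u p with true⇒ (W₂? u) p
    ... | inj₁ refl     = v∈
    ... | inj₂ (u∈ , _) = u∈
    cover : ∀ u → W u ≡ true → W₁ u ≡ true ⊎ W₂ u ≡ true
    cover u u∈ = by (R? u)
      where
      by : Dec (R u) → W₁ u ≡ true ⊎ W₂ u ≡ true
      by (yes w) = inj₁ (dec-true (W₁? u) (inj₂ w))
      by (no ¬w) = inj₂ (dec-true (W₂? u) (inj₂ (u∈ , ¬w)))
    meet : ∀ {u} → W₁ u ≡ true → W₂ u ≡ true → u ≡ v
    meet {u} p q with true⇒ (W₁? u) p | true⇒ (W₂? u) q
    ... | inj₁ eq | _              = ≡-sym eq
    ... | _       | inj₁ eq        = ≡-sym eq
    ... | inj₂ w  | inj₂ (_ , ¬w) = contradiction w ¬w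
    no-edge : ∀ {u w} → W₁ u ≡ true → W₂ w ≡ true → adj G u w ≡ true → u ≡ v ⊎ w ≡ v
    no-edge {u} {w} p q e with true⇒ (W₁? u) p | true⇒ (W₂? w) q
    ... | inj₁ eq | _              = inj₁ (≡-sym eq)
    ... | _       | inj₁ eq        = inj₂ (≡-sym eq)
    ... | inj₂ r  | inj₂ (w∈ , ¬r) with v ≟ w
    ... | yes eq = inj₂ (≡-sym eq)
    -- An edge from a vertex reachable from `x` to `w`, which differs from `v`, would make `w`
    -- reachable.
    ... | no v≢w = contradiction (walk-snoc r e (∖single⁺ W w∈ v≢w)) ¬r

  -- Such a W without cut vertex is a block of G and not just of G[W].
  Saturated : VSet (n G) → Set
  Saturated W = ∀ C → Connected G C → NoCutVertex G C
    → ∀ x y → C x ≡ true → C y ≡ true → x ≢ y → W x ≡ true → W y ≡ true → C ⊆ W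

  -- Saturation of `W` places `C` inside `W`. Of two distinct vertices in `W₁` at least one is not
  -- `v`, hence lies outside `W₂`, and then `C` cannot straddle the split.
  saturated₁ : ∀ {W W₁ W₂ v} → Split W W₁ W₂ v → Saturated W → Saturated W₁
  saturated₁ {W} {W₁} {W₂} s sat C conn ncv x y x∈C y∈C x≢y x∈ y∈
    with ∈-or-∉ W₂ x | ∈-or-∉ W₂ y
  ... | inj₁ p | inj₁ q = contradiction (trans (meet x∈ p) (≡-sym (meet y∈ q))) x≢y
    where open Split s
  ... | inj₂ p | _ = λ z → no-straddle s conn ncv C⊆W x∈C p
    where C⊆W = sat C conn ncv x y x∈C y∈C x≢y (Split.sub₁ s x x∈) (Split.sub₁ s y y∈)
  ... | inj₁ _ | inj₂ q = λ z → no-straddle s conn ncv C⊆W y∈C q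
    where C⊆W = sat C conn ncv x y x∈C y∈C x≢y (Split.sub₁ s x x∈) (Split.sub₁ s y y∈)

  -- A larger connected set without cut vertex still contains `x` and `y`, so saturation forces it
  -- back into `W`.
  saturated⇒block : ∀ {W} → Connected G W → Nontrivial W → Saturated W → NoCutVertex G W → IsBlock G W
  saturated⇒block conn (x , y , x∈ , y∈ , x≢y) sat ncv =
    conn , ncv , λ B' W⊆B' conn' ncv' → sat B' conn' ncv' x y (W⊆B' x x∈) (W⊆B' y y∈) x≢y x∈ y∈

  -- Recursive decomposition into blocks

  module _ {r : ℕ} (B : Fin r → VSet (n G)) (block : ∀ i → IsBlock G (B i))
    (distinct : ∀ i j → (∀ v → B i v ≡ B j v) → i ≡ j)
    (complete : ∀ B' → IsBlock G B' → ∃ λ i → ∀ v → B' v ≡ B i v)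
    (m : Fin r → ℕ) (mvd : ∀ i → IsMvd G (B i) (m i)) where

    -- The invariant of the recursion. The count is written as a sum on both sides to avoid
    -- truncated subtraction, and `all-inside` refers to blocks of the whole of `G`, so that for
    -- `full` it yields every index.
    record Decomposition (W : VSet (n G)) : Set where
      field
        blocks       : List (Fin r)
        unique       : Unique blocks
        inside       : ∀ {i} → i ∈ blocks → B i ⊆ W
        nontrivial   : ∀ {i} → i ∈ blocks → Nontrivial (B i)
        all-inside   : ∀ i → B i ⊆ W → i ∈ blocks
        value        : ℕ
        value-mvd    : IsMvd G W value
        value-blocks : value + length blocks ≡ sum (map m blocks) + 1

    leaf : ∀ {W} → Connected G W → Nontrivial W → Saturated W → NoCutVertex G W → Decomposition W
    leaf {W} conn (x , y , x∈ , y∈ , x≢y) sat ncv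
      with i , W≗B ← complete W (saturated⇒block conn (x , y , x∈ , y∈ , x≢y) sat ncv) = record
      { blocks       = i ∷ []
      ; unique       = [] ∷ []
      ; inside       = λ { (here refl) → ≗⇒⊆ (≡-sym ∘ W≗B) }
      ; nontrivial   = λ { (here refl) → x , y , ≗⇒⊆ W≗B x x∈ , ≗⇒⊆ W≗B y y∈ , x≢y }
      -- A block inside `W` equals `W` by its own maximality, hence has the index `i`.
      ; all-inside   = λ j Bj⊆W → here (distinct j i λ u →
                         trans (⊆-antisym Bj⊆W (proj₂ (proj₂ (block j)) W Bj⊆W conn ncv) u) (W≗B u))
      ; value        = m i
      ; value-mvd    = mvd-cong (≡-sym ∘ W≗B) (mvd i)
      ; value-blocks = cong (_+ 1) (+-comm 0 (m i))
      }

    -- Every block in `W` lies on one side, so concatenating the two lists misses none.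
    node : ∀ {W W₁ W₂ v} → Split W W₁ W₂ v → Decomposition W₁ → Decomposition W₂ → Decomposition W
    node {W} {W₁} {W₂} {v} s D₁ D₂ with mvd-split s (D₁ .Decomposition.value-mvd) (D₂ .Decomposition.value-mvd)
    ... | M , M-mvd , sucM≡ = record
      { blocks       = L₁ ++ L₂
      ; unique       = ++⁺ D₁.unique D₂.unique disjoint
      ; inside       = λ i∈ → [ (λ i∈₁ u → sub₁ u ∘ D₁.inside i∈₁ u) , (λ i∈₂ u → sub₂ u ∘ D₂.inside i∈₂ u) ]′ (∈-++⁻ L₁ i∈)
      ; nontrivial   = λ i∈ → [ D₁.nontrivial , D₂.nontrivial ]′ (∈-++⁻ L₁ i∈)
      ; all-inside   = λ i Bi⊆W → [ ∈-++⁺ˡ ∘ D₁.all-inside i , ∈-++⁺ʳ L₁ ∘ D₂.all-inside i ]′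
                         (one-side s (proj₁ (block i)) (proj₁ (proj₂ (block i))) Bi⊆W)
      ; value        = M
      ; value-mvd    = M-mvd
      ; value-blocks = count
      }
      where
      open Split s
      module D₁ = Decomposition D₁
      module D₂ = Decomposition D₂
      L₁ = D₁.blocks
      L₂ = D₂.blocks
      disjoint : ∀ {i} → ¬ (i ∈ L₁ × i ∈ L₂)
      -- A block on both sides would have `v` as its only vertex, yet it has two distinct vertices.
      disjoint (i∈₁ , i∈₂) with D₁.nontrivial i∈₁
      ... | x , y , x∈ , y∈ , x≢y = x≢y (trans (at-v x x∈) (≡-sym (at-v y y∈)))
        where at-v = λ u u∈ → meet (D₁.inside i∈₁ u u∈) (D₂.inside i∈₂ u u∈)
      count : M + length (L₁ ++ L₂) ≡ sum (map m (L₁ ++ L₂)) + 1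
      -- The two sides contribute `1` each; one of these cancels against the color shared at `v`,
      -- recorded by `sucM≡`.
      count = suc-injective (begin
        suc (M + length (L₁ ++ L₂))                        ≡⟨ cong₂ _+_ sucM≡ (length-++ L₁) ⟩
        (D₁.value + D₂.value) + (length L₁ + length L₂)    ≡⟨ shuffle D₁.value D₂.value (length L₁) (length L₂) ⟩
        (D₁.value + length L₁) + (D₂.value + length L₂)    ≡⟨ cong₂ _+_ D₁.value-blocks D₂.value-blocks ⟩
        (sum (map m L₁) + 1) + (sum (map m L₂) + 1)        ≡⟨ collect (sum (map m L₁)) (sum (map m L₂)) ⟩
        suc ((sum (map m L₁) + sum (map m L₂)) + 1)        ≡⟨ cong (λ t → suc (t + 1)) (sum-++ (map m L₁) (map m L₂)) ⟨
        suc (sum (map m L₁ ++ map m L₂) + 1)               ≡⟨ cong (λ t → suc (sum t + 1)) (map-++ m L₁ L₂) ⟨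
        suc (sum (map m (L₁ ++ L₂)) + 1)                   ∎)
        where
        open ≡-Reasoning
        open +-*-Solver
        shuffle : ∀ a b c d → (a + b) + (c + d) ≡ (a + c) + (b + d)
        shuffle = solve 4 (λ a b c d → (a :+ b) :+ (c :+ d) := (a :+ c) :+ (b :+ d)) refl
        collect : ∀ a b → (a + 1) + (b + 1) ≡ suc ((a + b) + 1)
        collect = solve 2 (λ a b → (a :+ con 1) :+ (b :+ con 1) := con 1 :+ ((a :+ b) :+ con 1)) refl

    decompose : ∀ k W → size W < k → Connected G W → Nontrivial W → Saturated W → Decomposition W
    decompose (suc k) W b conn nt sat with cutVertex? W
    ... | no ncv = leaf conn nt sat (λ v cv → ncv (v , cv))
    ... | yes cv with cut-split cv
    ... | W₁ , W₂ , s , nt₁ , nt₂ , W₁< , W₂< = node s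
      (decompose k W₁ (≤-trans W₁< (≤-pred b)) (connected₁ s conn) nt₁ (saturated₁ s sat))
      (decompose k W₂ (≤-trans W₂< (≤-pred b)) (connected₁ s' conn) nt₂ (saturated₁ s' sat))
      where s' = split-swap s

-- Comparison with the given enumeration of blocks

two-vertices : ∀ {k} → 2 ≤ k → Σ (Fin k) λ x → Σ (Fin k) λ y → x ≢ y
two-vertices (s≤s (s≤s _)) = zero , suc zero , λ ()

theorem1p3 : (G : Graph) → KappaOne G
    → (r : ℕ) (B : Fin r → VSet (n G))
    → (∀ i → IsBlock G (B i))
    → (∀ i j → (∀ v → B i v ≡ B j v) → i ≡ j)
    → (∀ B' → IsBlock G B' → ∃ λ i → ∀ v → B' v ≡ B i v)
    → (m : Fin r → ℕ) → (∀ i → IsMvd G (B i) (m i))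
    → IsMvd G full (ΣFin r m + 1 ∸ r)
theorem1p3 G (conn , 2≤n , _) r B block distinct complete m mvd
  with x , y , x≢y ← two-vertices 2≤n = subst (IsMvd G full) value≡ value-mvd
  where
  -- Saturation of `full` is immediate, because it contains every vertex.
  open Decomposition (decompose G B block distinct complete m mvd _ full ≤-refl conn
    (x , y , refl , refl , x≢y) (λ _ _ _ _ _ _ _ _ _ _ _ _ → refl))
  -- Both lists are free of repetitions and contain every index, so they agree up to order.
  blocks↭ : blocks ↭ allFin r
  blocks↭ = ∼bag⇒↭ (unique∧set⇒bag unique (allFin⁺ r)
    (λ {i} → mk⇔ (λ _ → ∈-allFin i) (λ _ → all-inside i (λ _ _ → refl))))
  value≡ : value ≡ ΣFin r m + 1 ∸ r
  value≡ = begin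
    value                                        ≡⟨ m+n∸n≡m value (length blocks) ⟨
    value + length blocks ∸ length blocks        ≡⟨ cong (_∸ length blocks) value-blocks ⟩
    sum (map m blocks) + 1 ∸ length blocks       ≡⟨ cong₂ (λ t l → t + 1 ∸ l) (sum-↭ (map⁺ m blocks↭))
                                                      (trans (↭-length blocks↭) (length-tabulate {n = r} id)) ⟩
    ΣFin r m + 1 ∸ r                             ∎
    where open ≡-Reasoning
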